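{- For every non-negative integer $t$ there is a constant $c_t$ such that every hypergraph $H$ with twin-width at most $t$ satisfies $\tau(H)\leqslant c_t\cdot\mu(H)$.
   Context: For a hypergraph $H$ with vertex set $V(H)$ and hyperedge set $E(H)$: $\tau(H)$ is the minimum size of a hitting set (a set of vertices meeting every hyperedge) and $\mu(H)$ is the maximum size of a packing (a set of pairwise disjoint hyperedges). The incidence bipartite graph $B(H)$ has vertex set $V(H)\cup E(H)$ with $ve$ an edge whenever $v\in e$; the twin-width of $H$ is the twin-width of $B(H)$. For graphs: a trigraph has a vertex set, black edges and disjoint red edges; contracting two (not necessarily adjacent) vertices $u,v$ replaces them by a new vertex $z$ with, for each other vertex $x$: $zx$ black if $ux,vx$ both black, red if $x$ is adjacent (black or red) to at least one of $u,v$ but not both via black edges, absent otherwise. A $d$-sequence of an $n$-vertex graph $G$ is a sequence of trigraphs $G=G_n,\ldots,G_1$ whose red graphs have maximum degree at most $d$, with $G_1$ a single vertex and each obtained from the previous by one contraction; the twin-width is the least such $d$. -}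

module Defs where

open import Data.Nat using (ℕ; zero; suc; _+_; _*_; _≤_)
open import Data.Fin using (Fin; splitAt)
open import Data.Fin.Subset using (Subset; _∈_; ∣_∣)
open import Data.Bool using (Bool; true; false; if_then_else_)
open import Data.List using (List; map; allFin)
open import Data.Nat.ListAction using (sum)
open import Data.Sum using (_⊎_; inj₁; inj₂)
open import Data.Product using (Σ; ∃; _×_; _,_)
open import Relation.Binary.PropositionalEquality using (_≡_; _≢_)
open import Relation.Nullary using (¬_)

data Col : Set where
  none black red : Col

record Trigraph (k : ℕ) : Set where
  field
    col : Fin k → Fin k → Col
    sym : ∀ x y → col x y ≡ col y x
    irr : ∀ x → col x x ≡ none
open Trigraph public

-- colour of zx when contracting u,v into z, given colours of ux and vx
comb : Col → Col → Col
comb black black = black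
comb none  none  = none
comb _     _     = red

isRed : Col → Bool
isRed red = true
isRed _   = false

redDeg : ∀ {k} → Trigraph k → Fin k → ℕ
redDeg {k} G x = sum (map (λ y → if isRed (col G x y) then 1 else 0) (allFin k))

RedDegAtMost : ℕ → ∀ {k} → Trigraph k → Set
RedDegAtMost d G = ∀ x → redDeg G x ≤ d

-- G' is obtained from G by contracting two distinct vertices u, v;
-- f : V(G) → V(G') sends u, v to the new vertex z and is otherwise a bijection.
Contraction : ∀ {k} → Trigraph (suc k) → Trigraph k → Set
Contraction {k} G G' =
  Σ (Fin (suc k)) λ u → Σ (Fin (suc k)) λ v → Σ (Fin (suc k) → Fin k) λ f →
    u ≢ v × f u ≡ f v
    × (∀ x y → f x ≡ f y → x ≡ y ⊎ ((x ≡ u × y ≡ v) ⊎ (x ≡ v × y ≡ u)))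
    × (∀ x y → x ≢ u → x ≢ v → y ≢ u → y ≢ v → col G' (f x) (f y) ≡ col G x y)
    × (∀ x → x ≢ u → x ≢ v → col G' (f u) (f x) ≡ comb (col G u x) (col G v x))

data Seq (d : ℕ) : (k : ℕ) → Trigraph k → Set where
  last : (G : Trigraph 1) → RedDegAtMost d G → Seq d 1 G
  step : ∀ {k} {G : Trigraph (suc (suc k))} (G' : Trigraph (suc k)) →
         RedDegAtMost d G → Contraction G G' → Seq d (suc k) G' →
         Seq d (suc (suc k)) G

-- twin-width at most d (the empty graph has twin-width 0)
TwwAtMost : ℕ → ∀ {n} → Trigraph n → Set
TwwAtMost d {n} G = n ≡ 0 ⊎ Seq d n G

-- Finite hypergraphs: vertices Fin nV, hyperedges Fin nE (indexed family),
-- inc v e = true iff v ∈ e.  Hyperedges are nonempty.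

record Hypergraph : Set where
  field
    nV nE : ℕ
    inc : Fin nV → Fin nE → Bool
    nonempty : ∀ e → ∃ λ v → inc v e ≡ true
open Hypergraph public

incCol : (H : Hypergraph) → Fin (nV H) ⊎ Fin (nE H) → Fin (nV H) ⊎ Fin (nE H) → Col
incCol H (inj₁ v) (inj₂ e) = if inc H v e then black else none
incCol H (inj₂ e) (inj₁ v) = if inc H v e then black else none
incCol H (inj₁ _) (inj₁ _) = none
incCol H (inj₂ _) (inj₂ _) = none

incColSym : (H : Hypergraph) → ∀ a b → incCol H a b ≡ incCol H b a
incColSym H (inj₁ v) (inj₂ e) = _≡_.refl
incColSym H (inj₂ e) (inj₁ v) = _≡_.refl
incColSym H (inj₁ _) (inj₁ _) = _≡_.refl
incColSym H (inj₂ _) (inj₂ _) = _≡_.refl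

incColIrr : (H : Hypergraph) → ∀ a → incCol H a a ≡ none
incColIrr H (inj₁ _) = _≡_.refl
incColIrr H (inj₂ _) = _≡_.refl

B : (H : Hypergraph) → Trigraph (nV H + nE H)
B H = record
  { col = λ x y → incCol H (splitAt (nV H) x) (splitAt (nV H) y)
  ; sym = λ x y → incColSym H (splitAt (nV H) x) (splitAt (nV H) y)
  ; irr = λ x → incColIrr H (splitAt (nV H) x)
  }

HypTwwAtMost : ℕ → Hypergraph → Set
HypTwwAtMost d H = TwwAtMost d (B H)

IsHittingSet : (H : Hypergraph) → Subset (nV H) → Set
IsHittingSet H S = ∀ e → ∃ λ v → v ∈ S × inc H v e ≡ true

IsPacking : (H : Hypergraph) → Subset (nE H) → Set
IsPacking H P = ∀ e e' → e ∈ P → e' ∈ P → e ≢ e' →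
  ¬ (∃ λ v → inc H v e ≡ true × inc H v e' ≡ true)

IsTau : (H : Hypergraph) → ℕ → Set
IsTau H t = (∃ λ S → IsHittingSet H S × ∣ S ∣ ≡ t)
          × (∀ S → IsHittingSet H S → t ≤ ∣ S ∣)

IsMu : (H : Hypergraph) → ℕ → Set
IsMu H m = (∃ λ P → IsPacking H P × ∣ P ∣ ≡ m)
         × (∀ P → IsPacking H P → ∣ P ∣ ≤ m)

{-# OPTIONS --safe #-}

-- The hitting set is built greedily: it suffices to find, in every nonempty set
-- A of hyperedges, some e such that boundedly many vertices hit all members of
-- A that meet e.  Follow the contraction sequence up to the first trigraph in
-- which some part p has the property that no single vertex hits all members of
-- A in p, and take e in p.  A part joined to p by a black edge has no vertices
-- of H, so the vertices of e lie in p and its at most t red neighbours.  Let q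
-- be one of these.  Hyperedges meeting q lie in q, in a black neighbour of q
-- (hit by any vertex of q) or in a red neighbour of q; and each part, being a
-- union of at most two parts of the previous trigraph, is hit by boundedly many
-- vertices.
module Submission where

open import Defs
open import Data.Nat using (ℕ; zero; suc; _+_; _*_; _≤_; _<_; z≤n; s≤s)
open import Data.Nat.Properties
  using (≤-refl; ≤-trans; ≤-reflexive; +-mono-≤; +-monoʳ-≤; *-monoˡ-≤;
         *-monoʳ-≤; +-suc; *-suc; m≤n⇒m≤1+n; module ≤-Reasoning)
open import Data.Nat.Induction using (<-wellFounded)
open import Data.Nat.ListAction using (sum)
open import Induction.WellFounded using (Acc; acc)
open import Data.Bool using (Bool; true; false; if_then_else_; T)
open import Data.Bool.Properties using (T?)
import Data.Bool.Properties as Bool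
open import Data.Fin using (Fin; zero; suc; _↑ˡ_; _↑ʳ_; splitAt)
open import Data.Fin.Properties
  using (any?; all?; _≟_; ¬∀⟶∃¬; splitAt-↑ˡ; splitAt-↑ʳ)
open import Data.Fin.Subset using (Subset; inside; outside; ⁅_⁆; _∪_; ⋃; ⊥; ∣_∣)
  renaming (_∈_ to _∈ₛ_)
open import Data.Fin.Subset.Properties
  using (∉⊥; ∣⊥∣≡0; ∣⁅x⁆∣≡1; x∈⁅x⁆; x∈⁅y⁆⇒x≡y; p⊂q⇒∣p∣<∣q∣; p⊆p∪q; q⊆p∪q; x∈p∪q⁻)
open import Data.List using (List; []; _∷_; _++_; map; length; filterᵇ; filter; concatMap; allFin)
open import Data.List.Properties using (length-++; length-map; filter-notAll)
open import Data.List.Membership.Propositional using (_∈_; lose; find)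
open import Data.List.Membership.Propositional.Properties
  using (∈-filter⁺; ∈-filter⁻; ∈-allFin)
open import Data.List.Relation.Unary.All using (All; []; _∷_)
import Data.List.Relation.Unary.All as All
import Data.List.Relation.Unary.Any as Any
open import Data.List.Relation.Unary.All.Properties using (¬All⇒Any¬)
open import Data.List.Relation.Unary.Any using (Any; here; there)
open import Data.List.Relation.Unary.Any.Properties using (concatMap⁺; ++⁺ˡ; ++⁺ʳ; map⁺)
open import Data.Product using (∃; _×_; _,_; proj₁; proj₂)
open import Data.Sum using (_⊎_; inj₁; inj₂)
import Data.Sum as Sum
open import Data.Sum.Properties using (inj₂-injective)
open import Data.Vec using ([]; _∷_)
open import Function using (_∘_; id)
open import Relation.Binary.PropositionalEquality
  using (_≡_; _≢_; refl; trans; cong; cong₂; subst; ≢-sym) renaming (sym to ≡-sym)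
open import Relation.Nullary using (¬_; Dec; yes; no; contradiction; ¬?)
open import Relation.Nullary.Decidable using (_×-dec_; _→-dec_; decidable-stable)

-- Bounds on lists and finite subsets

length-filterᵇ : ∀ {A : Set} (p : A → Bool) xs →
  length (filterᵇ p xs) ≡ sum (map (λ x → if p x then 1 else 0) xs)
length-filterᵇ p [] = refl
length-filterᵇ p (x ∷ xs) with p x
... | true  = cong suc (length-filterᵇ p xs)
... | false = length-filterᵇ p xs

length-concatMap : ∀ {A B : Set} (f : A → List B) b → (∀ x → length (f x) ≤ b) →
  ∀ xs → length (concatMap f xs) ≤ length xs * b
length-concatMap f b f≤b [] = z≤n
length-concatMap f b f≤b (x ∷ xs) = begin
  length (f x ++ concatMap f xs)        ≡⟨ length-++ (f x) ⟩
  length (f x) + length (concatMap f xs) ≤⟨ +-mono-≤ (f≤b x) (length-concatMap f b f≤b xs) ⟩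
  b + length xs * b                     ∎
  where open ≤-Reasoning

-- An optional witness as a list, so that a missing one adds nothing when hitters are concatenated.
witnesses : ∀ {A : Set} {P : A → Set} → Dec (∃ P) → List A
witnesses (yes (a , _)) = a ∷ []
witnesses (no _)        = []

length-witnesses : ∀ {A : Set} {P : A → Set} (d : Dec (∃ P)) → length (witnesses d) ≤ 1
length-witnesses (yes _) = s≤s z≤n
length-witnesses (no _)  = z≤n

witnesses⁺ : ∀ {A : Set} {P : A → Set} (d : Dec (∃ P)) → ∃ P → Any P (witnesses d)
witnesses⁺ (yes (_ , pa)) _ = here pa
witnesses⁺ (no ¬∃)        e = contradiction e ¬∃

∣p∪q∣≤∣p∣+∣q∣ : ∀ {n} (p q : Subset n) → ∣ p ∪ q ∣ ≤ ∣ p ∣ + ∣ q ∣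
∣p∪q∣≤∣p∣+∣q∣ [] [] = z≤n
∣p∪q∣≤∣p∣+∣q∣ (outside ∷ p) (outside ∷ q) = ∣p∪q∣≤∣p∣+∣q∣ p q
∣p∪q∣≤∣p∣+∣q∣ (outside ∷ p) (inside ∷ q) =
  ≤-trans (s≤s (∣p∪q∣≤∣p∣+∣q∣ p q)) (≤-reflexive (≡-sym (+-suc ∣ p ∣ ∣ q ∣)))
∣p∪q∣≤∣p∣+∣q∣ (inside ∷ p) (outside ∷ q) = s≤s (∣p∪q∣≤∣p∣+∣q∣ p q)
∣p∪q∣≤∣p∣+∣q∣ (inside ∷ p) (inside ∷ q) =
  s≤s (≤-trans (∣p∪q∣≤∣p∣+∣q∣ p q) (+-monoʳ-≤ ∣ p ∣ (m≤n⇒m≤1+n ≤-refl)))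

fromList : ∀ {n} → List (Fin n) → Subset n
fromList = ⋃ ∘ map ⁅_⁆

∣fromList∣≤length : ∀ {n} (xs : List (Fin n)) → ∣ fromList xs ∣ ≤ length xs
∣fromList∣≤length {n} [] = ≤-reflexive (∣⊥∣≡0 n)
∣fromList∣≤length (x ∷ xs) = begin
  ∣ ⁅ x ⁆ ∪ fromList xs ∣       ≤⟨ ∣p∪q∣≤∣p∣+∣q∣ ⁅ x ⁆ (fromList xs) ⟩
  ∣ ⁅ x ⁆ ∣ + ∣ fromList xs ∣   ≤⟨ +-mono-≤ (≤-reflexive (∣⁅x⁆∣≡1 x)) (∣fromList∣≤length xs) ⟩
  suc (length xs)               ∎
  where open ≤-Reasoning

∈-fromList : ∀ {n} {x : Fin n} {xs} → x ∈ xs → x ∈ₛ fromList xs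
∈-fromList {x = x} {_ ∷ xs} (here refl) = p⊆p∪q (fromList xs) (x∈⁅x⁆ x)
∈-fromList {xs = y ∷ xs}    (there x∈) = q⊆p∪q ⁅ y ⁆ (fromList xs) (∈-fromList x∈)

-- Red neighbourhoods and quotients of trigraphs

module _ {k} (G : Trigraph k) where

  -- The closed neighbourhood: `Quotient` says nothing about pairs inside one fibre, so a part has
  -- to be treated like a red neighbour of itself.
  redNbhd : Fin k → List (Fin k)
  redNbhd p = p ∷ filterᵇ (λ q → isRed (col G p q)) (allFin k)

  length-redNbhd : ∀ {d} → RedDegAtMost d G → ∀ p → length (redNbhd p) ≤ suc d
  length-redNbhd deg p = s≤s (≤-trans (≤-reflexive (length-filterᵇ _ (allFin k))) (deg p))

  red⇒∈redNbhd : ∀ {p q} → col G p q ≡ red → q ∈ redNbhd p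
  red⇒∈redNbhd {p} {q} eq = there (∈-filter⁺ (λ q → T? (isRed (col G p q))) (∈-allFin q)
    (subst (T ∘ isRed) (≡-sym eq) _))

-- For p ≢ q, a colour of pq other than red is the common colour of all pairs
-- between the fibres of p and q; edges inside a fibre are unconstrained.
Quotient : ∀ {m k} → Trigraph m → Trigraph k → (Fin m → Fin k) → Set
Quotient G G' π = ∀ x y → π x ≢ π y → col G' (π x) (π y) ≢ red →
  col G x y ≡ col G' (π x) (π y)

-- The colour given by the second quotient is not red, so it is also the colour in the middle
-- trigraph and the first quotient applies.
Quotient-∘ : ∀ {l m k} {G : Trigraph l} {G' : Trigraph m} {G'' : Trigraph k} {π ρ} →
  Quotient G G' π → Quotient G' G'' ρ → Quotient G G'' (ρ ∘ π)
Quotient-∘ {π = π} {ρ} Qπ Qρ x y apart ≢red =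
  trans (Qπ x y (apart ∘ cong ρ) (subst (_≢ red) (≡-sym eq) ≢red)) eq
  where eq = Qρ (π x) (π y) apart ≢red

comb-agree : ∀ a b → comb a b ≢ red → a ≡ comb a b × b ≡ comb a b
comb-agree none  none  _ = refl , refl
comb-agree none  black r = contradiction refl r
comb-agree none  red   r = contradiction refl r
comb-agree black none  r = contradiction refl r
comb-agree black black _ = refl , refl
comb-agree black red   r = contradiction refl r
comb-agree red   none  r = contradiction refl r
comb-agree red   black r = contradiction refl r
comb-agree red   red   r = contradiction refl r

-- By `comb-agree`, a colour other than red at the merged vertex was shared by `u` and `v`; pairs
-- away from both keep their colour.
Contraction⇒Quotient : ∀ {k} {G : Trigraph (suc k)} {G' : Trigraph k} →
  (C : Contraction G G') → Quotient G G' (proj₁ (proj₂ (proj₂ C)))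
Contraction⇒Quotient {G = G} {G'} (u , v , f , _ , fu≡fv , _ , colOld , colNew) = quotient
  where
  atU : ∀ y → f u ≢ f y → col G' (f u) (f y) ≢ red →
    col G u y ≡ col G' (f u) (f y) × col G v y ≡ col G' (f u) (f y)
  atU y apart ≢red = trans (proj₁ agree) (≡-sym eq) , trans (proj₂ agree) (≡-sym eq)
    where
    eq : col G' (f u) (f y) ≡ comb (col G u y) (col G v y)
    eq = colNew y (λ y≡u → apart (cong f (≡-sym y≡u)))
                  (λ y≡v → apart (trans fu≡fv (cong f (≡-sym y≡v))))
    agree = comb-agree (col G u y) (col G v y) (subst (_≢ red) eq ≢red)

  atMerged : ∀ x y → x ≡ u ⊎ x ≡ v → f x ≢ f y → col G' (f x) (f y) ≢ red →
    col G x y ≡ col G' (f x) (f y)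
  atMerged x y (inj₁ refl) apart ≢red = proj₁ (atU y apart ≢red)
  -- `colNew` names the merged vertex only as `f u`, so `f v` is rewritten to it.
  atMerged x y (inj₂ refl) rewrite ≡-sym fu≡fv = λ apart ≢red → proj₂ (atU y apart ≢red)

  merged? : ∀ x → (x ≡ u ⊎ x ≡ v) ⊎ (x ≢ u × x ≢ v)
  merged? x with x ≟ u | x ≟ v
  ... | yes x≡u | _       = inj₁ (inj₁ x≡u)
  ... | no _    | yes x≡v = inj₁ (inj₂ x≡v)
  ... | no x≢u  | no x≢v  = inj₂ (x≢u , x≢v)

  quotient : Quotient G G' f
  quotient x y apart ≢red with merged? x | merged? y
  ... | inj₁ x∈uv | _ = atMerged x y x∈uv apart ≢red
  ... | inj₂ _ | inj₁ y∈uv = trans (sym G x y) (trans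
    (atMerged y x y∈uv (≢-sym apart) (subst (_≢ red) (sym G' (f x) (f y)) ≢red))
    (sym G' (f y) (f x)))
  ... | inj₂ (x≢u , x≢v) | inj₂ (y≢u , y≢v) = ≡-sym (colOld x y x≢u x≢v y≢u y≢v)

Seq⇒RedDegAtMost : ∀ {d k} {G : Trigraph k} → Seq d k G → RedDegAtMost d G
Seq⇒RedDegAtMost (last _ deg)     = deg
Seq⇒RedDegAtMost (step _ deg _ _) = deg

-- The outer `suc t` counts the closed red neighbours of the part of `e`. Each of them contributes
-- one vertex of its own, for its black neighbours, and three hitters for each of its at most
-- `suc t` closed red neighbours.
gap : ℕ → ℕ
gap t = suc t * (1 + suc t * 3)

-- Meeting hyperedges and the incidence graph

module _ (H : Hypergraph) where

  V E : Set
  V = Fin (nV H)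
  E = Fin (nE H)

  Meet : E → E → Set
  Meet e f = ∃ λ v → inc H v e ≡ true × inc H v f ≡ true

  Meet? : ∀ e f → Dec (Meet e f)
  Meet? e f = any? λ v → (inc H v e Bool.≟ true) ×-dec (inc H v f Bool.≟ true)

  Meet-refl : ∀ e → Meet e e
  Meet-refl e = let v , v∈e = nonempty H e in v , v∈e , v∈e

  Meet-sym : ∀ {e f} → Meet e f → Meet f e
  Meet-sym (v , v∈e , v∈f) = v , v∈f , v∈e

  HitBy : List V → E → Set
  HitBy L f = Any (λ v → inc H v f ≡ true) L

  vtx : V → Fin (nV H + nE H)
  vtx v = v ↑ˡ nE H

  edg : E → Fin (nV H + nE H)
  edg e = nV H ↑ʳ e

  col-B : ∀ v e → col (B H) (vtx v) (edg e) ≡ (if inc H v e then black else none)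
  col-B v e rewrite splitAt-↑ˡ (nV H) v (nE H) | splitAt-↑ʳ (nV H) (nE H) e = refl

  -- Hitting the hyperedges of `A` part by part

  module _ (A : List E) where

    CoveredBy : ∀ {k} → (Fin (nV H + nE H) → Fin k) → Fin k → List V → Set
    CoveredBy π p L = All (λ f → π (edg f) ≡ p → HitBy L f) A

    OneHit : ∀ {k} → (Fin (nV H + nE H) → Fin k) → Fin k → Set
    OneHit π p = ∃ λ x → All (λ f → π (edg f) ≡ p → inc H x f ≡ true) A

    OneHit? : ∀ {k} (π : Fin (nV H + nE H) → Fin k) p → Dec (OneHit π p)
    OneHit? π p = any? λ x → All.all? (λ f → (π (edg f) ≟ p) →-dec (inc H x f Bool.≟ true)) A

    HittableNbhd : ℕ → Set
    HittableNbhd t = ∃ λ e → e ∈ A × ∃ λ L → length L ≤ gap t ×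
      (∀ f → f ∈ A → Meet e f → HitBy L f)

    module _ {k} {G : Trigraph k} {π : Fin (nV H + nE H) → Fin k} (Q : Quotient (B H) G π) where

      -- Between distinct parts not joined by a red edge all pairs have the same colour, and the
      -- incidence of `v` and `f` forces it to be black.
      near-or-complete : ∀ {v f} → inc H v f ≡ true →
        π (edg f) ∈ redNbhd G (π (vtx v)) ⊎
        (∀ v' f' → π (vtx v') ≡ π (vtx v) → π (edg f') ≡ π (edg f) → inc H v' f' ≡ true)
      near-or-complete {v} {f} v∈f with π (vtx v) ≟ π (edg f)
      ... | yes eq = inj₁ (here (≡-sym eq))
      ... | no apart with col G (π (vtx v)) (π (edg f)) in c
      ... | red = inj₁ (red⇒∈redNbhd G c)
      ... | none = contradiction
            (trans (≡-sym (trans (col-B v f) (cong (if_then black else none) v∈f)))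
                   (trans (Q (vtx v) (edg f) apart (λ r → contradiction (trans (≡-sym c) r) λ ())) c))
            λ ()
      ... | black = inj₂ complete
        where
        black⇒true : ∀ b → (if b then black else none) ≡ black → b ≡ true
        black⇒true true _ = refl
        complete : ∀ v' f' → π (vtx v') ≡ π (vtx v) → π (edg f') ≡ π (edg f) →
          inc H v' f' ≡ true
        complete v' f' eqv eqf = black⇒true _ (trans (≡-sym (col-B v' f'))
          (trans (Q (vtx v') (edg f')
                    (λ eq → apart (trans (≡-sym eqv) (trans eq eqf)))
                    (λ r → contradiction (trans (≡-sym c') r) λ ())) c'))
          where
          c' : col G (π (vtx v')) (π (edg f')) ≡ black
          c' = trans (cong₂ (col G) eqv eqf) c

      redNbhd-sym : ∀ {p q} → p ∈ redNbhd G q → q ∈ redNbhd G p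
      redNbhd-sym (here refl) = here refl
      redNbhd-sym {p} {q} (there p∈) = red⇒∈redNbhd G
        (trans (sym G p q) (isRed⇒red _ (proj₂ (∈-filter⁻ (λ r → T? (isRed (col G q r)))
          {xs = allFin k} p∈))))
        where
        isRed⇒red : ∀ c → T (isRed c) → c ≡ red
        isRed⇒red red _ = refl

      nbhd-of-bad-part : ∀ {t} → RedDegAtMost t G →
        (cover : ∀ p → ∃ λ L → length L ≤ 3 × CoveredBy π p L) →
        ∀ {e} → e ∈ A → ¬ OneHit π (π (edg e)) → HittableNbhd t
      nbhd-of-bad-part {t} deg cover {e} e∈A ¬one =
        e , e∈A , concatMap hitters (redNbhd G p) , bound , hits
        where
        p = π (edg e)

        -- If the part of a hyperedge is complete to `q`, any vertex in `q` hits it, so one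
        -- representative serves all such parts.
        rep? : ∀ q → Dec (∃ λ v → π (vtx v) ≡ q)
        rep? q = any? λ v → π (vtx v) ≟ q

        hitters : Fin k → List V
        hitters q = witnesses (rep? q) ++ concatMap (proj₁ ∘ cover) (redNbhd G q)

        length-hitters : ∀ q → length (hitters q) ≤ 1 + suc t * 3
        length-hitters q = ≤-trans (≤-reflexive (length-++ (witnesses (rep? q))))
          (+-mono-≤ (length-witnesses (rep? q))
            (≤-trans (length-concatMap (proj₁ ∘ cover) 3 (proj₁ ∘ proj₂ ∘ cover) (redNbhd G q))
                     (*-monoˡ-≤ 3 (length-redNbhd G deg q))))

        bound : length (concatMap hitters (redNbhd G p)) ≤ gap t
        bound = ≤-trans (length-concatMap hitters _ length-hitters (redNbhd G p))
          (*-monoˡ-≤ (1 + suc t * 3) (length-redNbhd G deg p))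

        hits-at : ∀ {v f} → f ∈ A → inc H v f ≡ true → HitBy (hitters (π (vtx v))) f
        hits-at {v} {f} f∈A v∈f with near-or-complete v∈f
        ... | inj₁ near = ++⁺ʳ (witnesses (rep? (π (vtx v)))) (concatMap⁺ (proj₁ ∘ cover)
                (lose near (All.lookup (proj₂ (proj₂ (cover (π (edg f))))) f∈A refl)))
        ... | inj₂ complete = ++⁺ˡ (Data.List.Relation.Unary.Any.map
                (λ eq → complete _ f eq refl) (witnesses⁺ (rep? _) (v , refl)))

        hits : ∀ f → f ∈ A → Meet e f → HitBy (concatMap hitters (redNbhd G p)) f
        hits f f∈A (v , v∈e , v∈f) with near-or-complete v∈e
        ... | inj₁ near = concatMap⁺ hitters (lose (redNbhd-sym near) (hits-at f∈A v∈f))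
        -- Here `v` would lie in every hyperedge of `p`, against the choice of `p`.
        ... | inj₂ complete = contradiction
                (v , All.tabulate λ {f'} _ eq → complete v f' refl eq) ¬one

    -- The merged part needs the hitters of u and v, any other part that of its
    -- unique preimage; listing all of them avoids distinguishing the two cases.
    contract-cover : ∀ {k} {G : Trigraph (suc k)} {G' : Trigraph k}
      {π : Fin (nV H + nE H) → Fin (suc k)} (C : Contraction G G') →
      (∀ p → OneHit π p) →
      ∀ p → ∃ λ L → length L ≤ 3 × CoveredBy (proj₁ (proj₂ (proj₂ C)) ∘ π) p L
    contract-cover {π = π} (u , v , f , _ , _ , inj , _) one p =
      hitter u ∷ hitter v ∷ map hitter (witnesses fibre?) ,
      s≤s (s≤s (≤-trans (≤-reflexive (length-map hitter (witnesses fibre?)))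
                        (length-witnesses fibre?))) ,
      All.tabulate covered
      where
      hitter = proj₁ ∘ one
      fibre? = any? λ a → f a ≟ p

      hit : ∀ {g} → g ∈ A → ∀ {a} → π (edg g) ≡ a → inc H (hitter a) g ≡ true
      hit g∈A {a} = All.lookup (proj₂ (one a)) g∈A

      covered : ∀ {g} → g ∈ A → f (π (edg g)) ≡ p →
        HitBy (hitter u ∷ hitter v ∷ map hitter (witnesses fibre?)) g
      covered {g} g∈A eq with π (edg g) ≟ u | π (edg g) ≟ v
      ... | yes ≡u | _      = here (hit g∈A ≡u)
      ... | no _   | yes ≡v = there (here (hit g∈A ≡v))
      -- The preimage of `p` found by `fibre?` is arbitrary, but `f` identifies only `u` and `v`, so
      -- it equals `π (edg g)`.
      ... | no ≢u  | no ≢v  = there (there (map⁺ (Any.map same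
              (witnesses⁺ fibre? (_ , eq)))))
        where
        same : ∀ {a} → f a ≡ p → inc H (hitter a) g ≡ true
        same {a} fa≡p with inj (π (edg g)) a (trans eq (≡-sym fa≡p))
        ... | inj₁ ≡a              = hit g∈A ≡a
        ... | inj₂ (inj₁ (≡u , _)) = contradiction ≡u ≢u
        ... | inj₂ (inj₂ (≡v , _)) = contradiction ≡v ≢v

    -- If no member of `A` lay in `p`, the given vertex would satisfy `OneHit` vacuously.
    bad-part-inhabited : V → ∀ {k} {π : Fin (nV H + nE H) → Fin k} {p} → ¬ OneHit π p →
      ∃ λ e → e ∈ A × π (edg e) ≡ p
    bad-part-inhabited x {π = π} {p} ¬one with All.all? (λ f → ¬? (π (edg f) ≟ p)) A
    ... | yes none-in-p = contradiction
            (x , All.map (λ ≢p ≡p → contradiction ≡p ≢p) none-in-p) ¬one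
    ... | no ¬all with find (¬All⇒Any¬ (λ f → ¬? (π (edg f) ≟ p)) A ¬all)
    ... | e , e∈A , ¬≢ = e , e∈A , decidable-stable (π (edg e) ≟ p) ¬≢

    -- Induction along the sequence. If every part is hit by one vertex, `contract-cover` provides
    -- the covers for the next trigraph; hence covers are at hand when the first bad part appears.
    hittable-nbhd-Seq : ∀ {t k} {G : Trigraph k} (π : Fin (nV H + nE H) → Fin k) {e} →
      e ∈ A → Seq t k G → Quotient (B H) G π →
      (∀ p → ∃ λ L → length L ≤ 3 × CoveredBy π p L) → HittableNbhd t
    hittable-nbhd-Seq {G = G} π {e} e∈A s Q cover with all? (OneHit? π)
    ... | no ¬all with ¬∀⟶∃¬ _ _ (OneHit? π) ¬all
    ... | p , ¬one with bad-part-inhabited (proj₁ (nonempty H e)) {π = π} ¬one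
    ... | e' , e'∈A , refl =
            nbhd-of-bad-part {G = G} {π} Q (Seq⇒RedDegAtMost s) cover e'∈A ¬one
    -- No bad part ever appeared: the single remaining part contains all of `A`, so one vertex hits
    -- everything and any `e` will do.
    hittable-nbhd-Seq π {e} e∈A (last _ _) _ _ | yes one =
      e , e∈A , x ∷ [] , s≤s z≤n , λ f f∈A _ → here (All.lookup hit f∈A (Fin1 (π (edg f))))
      where
      x = proj₁ (one zero)
      hit = proj₂ (one zero)
      Fin1 : (i : Fin 1) → i ≡ zero
      Fin1 zero = refl
    hittable-nbhd-Seq {G = G} π e∈A (step G' _ C s) Q _ | yes one =
      hittable-nbhd-Seq (proj₁ (proj₂ (proj₂ C)) ∘ π) e∈A s
        (Quotient-∘ {G = B H} {G} {G'} Q (Contraction⇒Quotient {G = G} {G'} C))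
        (contract-cover {G = G} {G'} {π} C one)

    -- The sequence starts from singleton parts. Each holds at most one hyperedge, which is nonempty
    -- and so is hit by one of its vertices.
    hittable-nbhd : ∀ {t e} → e ∈ A → HypTwwAtMost t H → HittableNbhd t
    hittable-nbhd {e = e} _ (inj₁ eq) with () ← subst Fin eq (edg e)
    hittable-nbhd {e = e} e∈A (inj₂ s) = hittable-nbhd-Seq id e∈A s (λ _ _ _ _ → refl) singleton
      where
      splitAt-edg : ∀ {f p} → edg f ≡ p → splitAt (nV H) p ≡ inj₂ f
      splitAt-edg {f} refl = splitAt-↑ʳ (nV H) (nE H) f

      singleton : ∀ p → ∃ λ L → length L ≤ 3 × CoveredBy id p L
      singleton p with splitAt (nV H) p in eq
      ... | inj₁ _ = [] , z≤n , All.tabulate λ _ f≡p →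
              contradiction (trans (≡-sym eq) (splitAt-edg f≡p)) λ ()
      ... | inj₂ e' = let v , v∈e' = nonempty H e' in
              v ∷ [] , s≤s z≤n , All.tabulate λ _ f≡p → here
                (subst (λ g → inc H v g ≡ true)
                  (inj₂-injective (trans (≡-sym eq) (splitAt-edg f≡p))) v∈e')

  -- Greedy construction of a hitting set and a packing

  record Greedy (c : ℕ) (A : List E) : Set where
    field
      hitters   : List V
      hits      : ∀ {f} → f ∈ A → HitBy hitters f
      packing   : Subset (nE H)
      isPacking : IsPacking H packing
      packing⊆A : ∀ {f} → f ∈ₛ packing → f ∈ A
      bound     : length hitters ≤ c * ∣ packing ∣

  -- Put `e` into the packing, hit all members of `A` meeting `e`, and recurse on those disjoint
  -- from `e`. The field `packing⊆A` guarantees that the recursive packing avoids `e`.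
  greedy : ∀ {t} → HypTwwAtMost t H → ∀ A → Acc _<_ (length A) → Greedy (gap t) A
  greedy tww [] _ = record
    { hitters   = []
    ; hits      = λ ()
    ; packing   = ⊥
    ; isPacking = λ _ _ e∈⊥ → contradiction e∈⊥ ∉⊥
    ; packing⊆A = λ f∈⊥ → contradiction f∈⊥ ∉⊥
    ; bound     = z≤n
    }
  greedy {t} tww A@(_ ∷ _) (acc rec) with hittable-nbhd A (here refl) tww
  ... | e , e∈A , L , L≤gap , L-hits = record
    { hitters   = L ++ R.hitters
    ; hits      = hits
    ; packing   = P
    ; isPacking = isPacking
    ; packing⊆A = packing⊆A
    ; bound     = bound
    }
    where
    avoids? = λ f → ¬? (Meet? e f)
    A' = filter avoids? A
    shorter : length A' < length A
    -- Being nonempty, `e` meets itself and is filtered out.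
    shorter = filter-notAll avoids? A (lose e∈A (λ ¬meet → ¬meet (Meet-refl e)))
    module R = Greedy (greedy tww A' (rec shorter))
    P = ⁅ e ⁆ ∪ R.packing

    avoids : ∀ {f} → f ∈ₛ R.packing → ¬ Meet e f
    avoids f∈ = proj₂ (∈-filter⁻ avoids? {xs = A} (R.packing⊆A f∈))

    hits : ∀ {f} → f ∈ A → HitBy (L ++ R.hitters) f
    hits {f} f∈A with Meet? e f
    ... | yes meet = ++⁺ˡ (L-hits f f∈A meet)
    ... | no ¬meet = ++⁺ʳ L (R.hits (∈-filter⁺ avoids? f∈A ¬meet))

    member : ∀ {f} → f ∈ₛ P → f ≡ e ⊎ f ∈ₛ R.packing
    member f∈P = Sum.map₁ (x∈⁅y⁆⇒x≡y e) (x∈p∪q⁻ ⁅ e ⁆ R.packing f∈P)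

    isPacking : IsPacking H P
    isPacking f g f∈P g∈P f≢g with member f∈P | member g∈P
    ... | inj₁ refl | inj₁ refl = contradiction refl f≢g
    ... | inj₁ refl | inj₂ g∈   = avoids g∈
    ... | inj₂ f∈   | inj₁ refl = avoids f∈ ∘ Meet-sym
    ... | inj₂ f∈   | inj₂ g∈   = R.isPacking f g f∈ g∈ f≢g

    packing⊆A : ∀ {f} → f ∈ₛ P → f ∈ A
    packing⊆A f∈P with member f∈P
    ... | inj₁ refl = e∈A
    ... | inj₂ f∈   = proj₁ (∈-filter⁻ avoids? (R.packing⊆A f∈))

    larger : ∣ R.packing ∣ < ∣ P ∣
    larger = p⊂q⇒∣p∣<∣q∣ (q⊆p∪q ⁅ e ⁆ R.packing ,
      e , p⊆p∪q R.packing (x∈⁅x⁆ e) , λ e∈ → avoids e∈ (Meet-refl e))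

    -- The packing gains at least one hyperedge, which pays for the at most `gap t` vertices of `L`.
    bound : length (L ++ R.hitters) ≤ gap t * ∣ P ∣
    bound = begin
      length (L ++ R.hitters)        ≡⟨ length-++ L ⟩
      length L + length R.hitters    ≤⟨ +-mono-≤ L≤gap R.bound ⟩
      gap t + gap t * ∣ R.packing ∣  ≡⟨ *-suc (gap t) ∣ R.packing ∣ ⟨
      gap t * suc ∣ R.packing ∣      ≤⟨ *-monoʳ-≤ (gap t) larger ⟩
      gap t * ∣ P ∣                  ∎
      where open ≤-Reasoning

theorem32 : (t : ℕ) → ∃ λ (c : ℕ) → (H : Hypergraph) → HypTwwAtMost t H →
    (τ μ : ℕ) → IsTau H τ → IsMu H μ → τ ≤ c * μ
theorem32 t = gap t , λ H tww τ μ (_ , τ≤) (_ , ≤μ) →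
  -- Run on all hyperedges, the construction bounds `τ` from above by its hitters and `μ` from below
  -- by its packing.
  let open Greedy (greedy H tww (allFin (nE H)) (<-wellFounded _))
      hitting : IsHittingSet H (fromList hitters)
      hitting e = let v , v∈ , v∈e = find (hits (∈-allFin e)) in v , ∈-fromList v∈ , v∈e
  in ≤-trans (τ≤ (fromList hitters) hitting)
    (≤-trans (∣fromList∣≤length hitters)
      (≤-trans bound (*-monoʳ-≤ (gap t) (≤μ packing isPacking))))
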